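{- Let $X$ be a set of variables and let $e,f$ be two expressions over $X$. The following properties are equivalent: (i) $\mathrm{Rel}\models e\leq f$; (ii) $T(e)\subseteq {\downarrow}T(f)$, where ${\downarrow}$ is downward closure with respect to the preorder $\lesssim$ on terms; (iii) $\mathcal G(e)\subseteq {\downarrow}\mathcal G(f)$, where ${\downarrow}$ is downward closure with respect to the preorder $\trianglelefteq$ on graphs.
   Context: Expressions over $X$ are given by $e,f ::= e\cup f \mid e\cdot f\mid e\cap f\mid e^+\mid e^{\circ}\mid 0\mid 1\mid\top\mid a$ ($a\in X$). Terms are the expressions that do not contain $0$, $\cup$ or $(\cdot)^+$. Relational semantics: given a set $S$ and $\sigma:X\to\mathcal P(S\times S)$, $\hat\sigma$ is the unique homomorphic extension of $\sigma$ to expressions, where $\cup,\cap$ are union and intersection, $\cdot$ is relational composition, $^+$ is transitive closure, $^\circ$ is converse, $0$ is the empty relation, $1$ is the identity relation on $S$ and $\top=S\times S$. $\mathrm{Rel}\models e\leq f$ means that $\hat\sigma(e)\subseteq\hat\sigma(f)$ for every set $S$ and every $\sigma:X\to\mathcal P(S\times S)$. The set of terms $T(e)$ of an expression: $T(e\cdot f)=\{u\cdot v\mid u\in T(e),v\in T(f)\}$, $T(e\cap f)=\{u\cap v\mid u\in T(e),v\in T(f)\}$, $T(e^\circ)=\{u^\circ\mid u\in T(e)\}$, $T(e\cup f)=T(e)\cup T(f)$, $T(e^+)=\bigcup_{n>0}\{u_1\cdots u_n\mid \forall i,\ u_i\in T(e)\}$, $T(0)=\emptyset$, $T(1)=\{1\}$,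 $T(\top)=\{\top\}$, $T(a)=\{a\}$. A graph over $X$ is a tuple $\langle V,E,\iota,o\rangle$ with $V$ a finite set of vertices, $E\subseteq V\times X\times V$ a set of labelled edges, $\iota,o\in V$ (input and output); graphs are considered up to isomorphism. The graph $\mathcal G(u)$ of a term: $\mathcal G(a)$ has two vertices (input and output) and a single edge labelled $a$ from input to output; $\mathcal G(u\cdot v)$ is obtained from the disjoint union of $\mathcal G(u)$ and $\mathcal G(v)$ by merging the output of $\mathcal G(u)$ with the input of $\mathcal G(v)$; $\mathcal G(u\cap v)$ by merging the two inputs and merging the two outputs; $\mathcal G(u^\circ)$ is $\mathcal G(u)$ with input and output swapped; $\mathcal G(1)$ has a single vertex (both input and output) and no edge; $\mathcal G(\top)$ has two vertices (input and output) and no edge. For an expression, $\mathcal G(e)=\{\mathcal G(u)\mid u\in T(e)\}$. A graph homomorphism from $\langle V_1,E_1,\iota_1,o_1\rangle$ to $\langle V_2,E_2,\iota_2,o_2\rangle$ is a map $\varphi:V_1\to V_2$ with $\varphi(\iota_1)=\iota_2$, $\varphi(o_1)=o_2$ and $(p,a,q)\in E_1\Rightarrow(\varphi(p),a,\varphi(q))\in E_2$. $G\trianglelefteq G'$ means there is a homomorphism from $G'$ to $G$. For terms, $u\lesssim v$ means $\mathcal G(u)\trianglelefteq\mathcal G(v)$. For a set $S$ of graphs (resp. terms), ${\downarrow}S$ is the set of graphs (resp. terms) below some element of $S$. -}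

module Defs where

open import Level using (Level; _⊔_) renaming (suc to lsuc)
open import Data.Empty.Polymorphic using (⊥)
open import Data.Fin.Base using (Fin; zero; suc; _↑ˡ_; _↑ʳ_; punchOut)
open import Data.Fin.Properties using (_≟_)
open import Data.Nat.Base using (ℕ; suc; _+_)
open import Data.Product.Base using (Σ-syntax; ∃; ∃₂; ∃-syntax; _×_; _,_)
open import Data.Vec.Base using (Vec; foldr₁)
open import Data.Vec.Relation.Unary.All using (All)
open import Function.Base using (id; flip)
open import Function.Bundles using (_↔_; _⇔_; Inverse)
open import Relation.Binary.Construct.Always using (Always)
open import Relation.Binary.Construct.Closure.Transitive using (TransClosure)
open import Relation.Binary.Construct.Composition using (_;_)
import Relation.Binary.Construct.Intersection as Rel∩
open import Relation.Binary.Construct.Never using (Never)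
import Relation.Binary.Construct.Union as Rel∪
open import Relation.Binary.Core using (Rel; _⇒_)
open import Relation.Binary.PropositionalEquality.Core using (_≡_; _≢_)
open import Relation.Nullary.Decidable.Core using (yes; no)
open import Relation.Unary using (Pred; ｛_｝)
import Relation.Unary as Pred

private
  variable
    a ℓ : Level
    m n : ℕ

infixr 7 _·_
infixr 6 _∩_
infixr 5 _∪_
infix  8 _⁺ _°

data Expr (X : Set a) : Set a where
  _∪_ _·_ _∩_ : Expr X → Expr X → Expr X
  _⁺ _°       : Expr X → Expr X
  𝟘 𝟙 ⊤       : Expr X
  var         : X → Expr X

-- The expressions without 𝟘, _∪_ and _⁺, as a datatype of their own.
data Term (X : Set a) : Set a where
  _·_ _∩_ : Term X → Term X → Term X
  _°      : Term X → Term X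
  𝟙 ⊤     : Term X
  var     : X → Term X

-- Subsets of S × S are Set-valued binary relations on S.
⟦_⟧ : {X : Set a} → Expr X → {S : Set ℓ} → (X → Rel S ℓ) → Rel S ℓ
⟦ e ∪ f ⟧ σ = ⟦ e ⟧ σ Rel∪.∪ ⟦ f ⟧ σ
⟦ e · f ⟧ σ = ⟦ e ⟧ σ ; ⟦ f ⟧ σ
⟦ e ∩ f ⟧ σ = ⟦ e ⟧ σ Rel∩.∩ ⟦ f ⟧ σ
⟦ e ⁺ ⟧   σ = TransClosure (⟦ e ⟧ σ)
⟦ e ° ⟧   σ = flip (⟦ e ⟧ σ)
⟦ 𝟘 ⟧     σ = Never
⟦ 𝟙 ⟧     σ = _≡_
⟦ ⊤ ⟧     σ = Always
⟦ var x ⟧ σ = σ x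

-- Rel⊨ ℓ e f is Rel ⊨ e ≤ f, with S ranging over the sets of the universe ℓ.
Rel⊨ : (ℓ : Level) {X : Set a} → Expr X → Expr X → Set (a ⊔ lsuc ℓ)
Rel⊨ ℓ {X} e f = {S : Set ℓ} (σ : X → Rel S ℓ) → ⟦ e ⟧ σ ⇒ ⟦ f ⟧ σ

-- A product u₁ ⋯ uₙ is bracketed to the right; the bracketing does not affect
-- its graph up to isomorphism.
T : {X : Set a} → Expr X → Pred (Term X) a
T (e ∪ f) = T e Pred.∪ T f
T (e · f) = λ w → ∃₂ λ u v → T e u × T f v × w ≡ u · v
T (e ∩ f) = λ w → ∃₂ λ u v → T e u × T f v × w ≡ u ∩ v
T (e ⁺)   = λ w → ∃ λ n → Σ[ us ∈ Vec (Term _) (suc n) ] (All (T e) us × w ≡ foldr₁ _·_ us)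
T (e °)   = λ w → ∃ λ u → T e u × w ≡ u °
T 𝟘       = λ _ → ⊥
T 𝟙       = ｛ 𝟙 ｝
T ⊤       = ｛ ⊤ ｝
T (var x) = ｛ var x ｝

-- A set of labelled edges on n vertices, as a subset of Fin n × X × Fin n.
Edges : Set a → ℕ → Set (lsuc a)
Edges {a} X n = Fin n → X → Fin n → Set a

-- Graphs matter only up to isomorphism, so the finite vertex set is some Fin n.
record Graph (X : Set a) : Set (lsuc a) where
  field
    size : ℕ
    edge : Edges X size
    ι o  : Fin size

open Graph

module _ {X : Set a} where

  record Hom (G H : Graph X) : Set a where
    field
      map      : Fin (size G) → Fin (size H)
      map-ι    : map (ι G) ≡ ι H
      map-o    : map (o G) ≡ o H
      map-edge : ∀ {p x q} → edge G p x q → edge H (map p) x (map q)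

  -- The order is contravariant: G ⊴ H is witnessed by a homomorphism from H to G.
  infix 4 _⊴_
  _⊴_ : Graph X → Graph X → Set a
  G ⊴ H = Hom H G

  infix 4 _≅_
  record _≅_ (G H : Graph X) : Set a where
    field
      bijection : Fin (size G) ↔ Fin (size H)
    open Inverse bijection using (to)
    field
      to-ι    : to (ι G) ≡ ι H
      to-o    : to (o G) ≡ o H
      to-edge : ∀ {p x q} → edge G p x q ⇔ edge H (to p) x (to q)

-- The quotient map of Fin (suc n) by the identification of j with i ≢ j: the
-- vertex j is removed, by sending it where i goes.
collapse : (i j : Fin (suc n)) → j ≢ i → Fin (suc n) → Fin n
collapse i j j≢i k with j ≟ k
... | yes _   = punchOut j≢i
... | no  j≢k = punchOut j≢k

-- The quotient of Fin n by the least equivalence relation identifying i and j,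
-- which is Fin n itself when i ≡ j.
merge : Fin n → Fin n → ∃[ k ] (Fin n → Fin k)
merge {n = suc n} i j with j ≟ i
... | yes _   = suc n , id
... | no  j≢i = n , collapse i j j≢i

module _ {X : Set a} where

  data Image (h : Fin m → Fin n) (E : Edges X m) : Edges X n where
    image : ∀ {p x q} → E p x q → Image h E (h p) x (h q)

  data _⊎ᴱ_ {m n} (E : Edges X m) (F : Edges X n) : Edges X (m + n) where
    left  : ∀ {p x q} → E p x q → (E ⊎ᴱ F) (p ↑ˡ n) x (q ↑ˡ n)
    right : ∀ {p x q} → F p x q → (E ⊎ᴱ F) (m ↑ʳ p) x (m ↑ʳ q)

  data Arrow (x : X) : Edges X 2 where
    arrow : Arrow x zero x (suc zero)

  series : Graph X → Graph X → Graph X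
  series G H =
    let inˡ   = _↑ˡ size H
        inʳ   = size G ↑ʳ_
        k , π = merge (inˡ (o G)) (inʳ (ι H))
    in record
      { size = k
      ; edge = Image π (edge G ⊎ᴱ edge H)
      ; ι    = π (inˡ (ι G))
      ; o    = π (inʳ (o H))
      }

  -- The inputs are merged first, then the images of the outputs; these may
  -- already coincide, for instance when ι ≡ o in both graphs.
  parallel : Graph X → Graph X → Graph X
  parallel G H =
    let inˡ   = _↑ˡ size H
        inʳ   = size G ↑ʳ_
        l , ρ = merge (inˡ (ι G)) (inʳ (ι H))
        k , π = merge (ρ (inˡ (o G))) (ρ (inʳ (o H)))
    in record
      { size = k
      ; edge = Image π (Image ρ (edge G ⊎ᴱ edge H))
      ; ι    = π (ρ (inˡ (ι G)))
      ; o    = π (ρ (inˡ (o G)))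
      }

  graph : Term X → Graph X
  graph (u · v) = series (graph u) (graph v)
  graph (u ∩ v) = parallel (graph u) (graph v)
  graph (u °)   = record { size = size G ; edge = edge G ; ι = o G ; o = ι G }
    where G = graph u
  graph 𝟙       = record { size = 1 ; edge = λ _ _ _ → ⊥ ; ι = zero ; o = zero }
  graph ⊤       = record { size = 2 ; edge = λ _ _ _ → ⊥ ; ι = zero ; o = suc zero }
  graph (var x) = record { size = 2 ; edge = Arrow x ; ι = zero ; o = suc zero }

  infix 4 _≲_
  _≲_ : Term X → Term X → Set a
  u ≲ v = graph u ⊴ graph v

  -- The set of the graphs of the terms of e, closed under isomorphism since
  -- graphs are considered up to isomorphism.
  𝒢 : Expr X → Pred (Graph X) a
  𝒢 e G = ∃ λ u → T e u × G ≅ graph u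

↓[_] : ∀ {b r p} {A : Set b} → Rel A r → Pred A p → Pred A (b ⊔ r ⊔ p)
↓[ _≤_ ] P x = ∃ λ y → P y × x ≤ y

{-# OPTIONS --safe #-}

-- A pair (s , t) belongs to the interpretation of a term u exactly when 𝒢(u) maps
-- homomorphically into the structure (S, σ) with input s and output t: this holds
-- because gluing vertices has the universal property of a quotient.  Hence the
-- interpretation of e is the union of these conditions over T(e).  Composing
-- homomorphisms gives (ii) ⇒ (i); evaluating e and f in the structure 𝒢(u) itself,
-- at the identity homomorphism, gives (i) ⇒ (ii).
module Submission where

open import Defs
open import Level using (Level; _⊔_; Lift; lift; lower)
open import Data.Fin.Base using (Fin; zero; suc; _↑ˡ_; _↑ʳ_; punchIn)
open import Data.Fin.Properties using (_≟_; punchIn-punchOut; punchOut-cong)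
open import Data.Nat.Base using (ℕ; suc; _+_)
open import Data.Product.Base using (∃; ∃-syntax; _×_; _,_; proj₁; proj₂)
open import Data.Sum.Base using (inj₁; inj₂)
open import Data.Unit.Polymorphic.Base using (tt)
open import Data.Vec.Base using (Vec; []; _∷_; foldr₁)
import Data.Vec.Functional as Vector
open import Data.Vec.Functional.Properties using (lookup-++ˡ; lookup-++ʳ)
open import Data.Vec.Relation.Unary.All using (All; []; _∷_)
open import Function.Base using (_∘_)
open import Function.Bundles using (_⇔_; mk⇔; Inverse; Equivalence)
open import Function.Construct.Identity using (↔-id; ⇔-id)
open import Relation.Binary.Construct.Closure.Transitive using (TransClosure; [_]; _∷_)
open import Relation.Binary.Core using (Rel)
open import Relation.Binary.PropositionalEquality
  using (_≡_; _≢_; _≗_; refl; sym; trans; cong; subst₂)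
open import Relation.Nullary.Decidable.Core using (yes; no)
open import Relation.Nullary.Negation using (contradiction)
open import Relation.Unary using (_⊆_)

open Graph

private
  variable
    a ℓ : Level
    m n : ℕ

-- Gluing two vertices as a quotient.

collapse-glues : (i j : Fin (suc n)) (j≢i : j ≢ i) →
  collapse i j j≢i i ≡ collapse i j j≢i j
collapse-glues i j j≢i with j ≟ i | j ≟ j
... | yes j≡i | _      = contradiction j≡i j≢i
-- Both sides remove `j` from `i`; they differ only in the proof that `j ≢ i`.
... | no  _   | yes _  = punchOut-cong j refl
... | no  _   | no j≢j = contradiction refl j≢j

merge-glues : (i j : Fin n) → proj₂ (merge i j) i ≡ proj₂ (merge i j) j
merge-glues {suc n} i j with j ≟ i
... | yes j≡i = sym j≡i
... | no  j≢i = collapse-glues i j j≢i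

module _ {S : Set ℓ} where

  -- `punchIn j` picks the surviving representative of each class. Only `j` is moved by this choice,
  -- to `i`, where `h` takes the same value.
  collapse-factors : (i j : Fin (suc n)) (j≢i : j ≢ i) (h : Fin (suc n) → S) →
    h i ≡ h j → h ∘ punchIn j ∘ collapse i j j≢i ≗ h
  collapse-factors i j j≢i h hi≡hj k with j ≟ k
  ... | yes refl = trans (cong h (punchIn-punchOut j≢i)) hi≡hj
  ... | no  j≢k  = cong h (punchIn-punchOut j≢k)

  merge-factors : (i j : Fin n) (h : Fin n → S) → h i ≡ h j →
    ∃ λ h′ → h′ ∘ proj₂ (merge i j) ≗ h
  merge-factors {suc n} i j h hi≡hj with j ≟ i
  ... | yes _   = h , λ _ → refl
  ... | no  j≢i = h ∘ punchIn j , collapse-factors i j j≢i h hi≡hj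

-- Homomorphisms from graphs to relational structures.

module _ {X : Set a} {S : Set ℓ} (σ : X → Rel S ℓ) where

  Preserves : Edges X n → (Fin n → S) → Set (a ⊔ ℓ)
  Preserves E h = ∀ {p x q} → E p x q → σ x (h p) (h q)

  -- Copairings and factorizations through a quotient satisfy their equations only pointwise, so
  -- edge preservation has to be transported along `≗`.
  preserves-resp-≗ : {E : Edges X n} {g h : Fin n → S} → g ≗ h →
    Preserves E g → Preserves E h
  preserves-resp-≗ g≗h pres {x = x} e = subst₂ (σ x) (g≗h _) (g≗h _) (pres e)

  preserves-Image : {π : Fin m → Fin n} {E : Edges X m} {h : Fin n → S} →
    Preserves E (h ∘ π) → Preserves (Image π E) h
  preserves-Image pres (image e) = pres e

  preserves-⊎ᴱ : {E : Edges X m} {F : Edges X n} {h : Fin (m + n) → S} →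
    Preserves E (h ∘ (_↑ˡ n)) → Preserves F (h ∘ (m ↑ʳ_)) → Preserves (E ⊎ᴱ F) h
  preserves-⊎ᴱ presˡ presʳ (left e)  = presˡ e
  preserves-⊎ᴱ presˡ presʳ (right e) = presʳ e

  -- Homomorphisms from G to the structure (S, σ) with input s and output t; S
  -- need not be finite.
  record Match (G : Graph X) (s t : S) : Set (a ⊔ ℓ) where
    constructor match
    field
      map      : Fin (size G) → S
      map-ι    : map (ι G) ≡ s
      map-o    : map (o G) ≡ t
      map-edge : Preserves (edge G) map

  module _ {G H : Graph X} where

    private
      inˡ : Fin (size G) → Fin (size G + size H)
      inˡ = _↑ˡ size H

      inʳ : Fin (size H) → Fin (size G + size H)
      inʳ = size G ↑ʳ_

    module _ (g : Fin (size G) → S) (h : Fin (size H) → S) where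

      copair : Fin (size G + size H) → S
      copair = g Vector.++ h

      copair-ˡ : copair ∘ inˡ ≗ g
      copair-ˡ = lookup-++ˡ g h

      copair-ʳ : copair ∘ inʳ ≗ h
      copair-ʳ = lookup-++ʳ g h

      copair-preserves : Preserves (edge G) g → Preserves (edge H) h →
        Preserves (edge G ⊎ᴱ edge H) copair
      copair-preserves presˡ presʳ = preserves-⊎ᴱ
        (preserves-resp-≗ {E = edge G} (sym ∘ copair-ˡ) presˡ)
        (preserves-resp-≗ {E = edge H} (sym ∘ copair-ʳ) presʳ)

    -- Both maps take the value `r` at the vertices to be glued, so their copairing descends to the
    -- quotient.
    match-series : ∀ {s r t} → Match G s r → Match H r t → Match (series G H) s t
    match-series (match g gι go ge) (match h hι ho he)
      with k , kπ ← merge-factors (inˡ (o G)) (inʳ (ι H)) (copair g h)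
             (trans (copair-ˡ g h (o G)) (trans go (sym (trans (copair-ʳ g h (ι H)) hι))))
      = match k
          (trans (kπ _) (trans (copair-ˡ g h (ι G)) gι))
          (trans (kπ _) (trans (copair-ʳ g h (o H)) ho))
          (preserves-Image (preserves-resp-≗ {E = edge G ⊎ᴱ edge H} (sym ∘ kπ)
            (copair-preserves g h ge he)))

    unmatch-series : ∀ {s t} → Match (series G H) s t →
      ∃[ r ] Match G s r × Match H r t
    unmatch-series (match k kι ko ke) =
      -- The midpoint is the image under `k` of the glued vertex: `refl` fixes it on the side of
      -- `G`, and `merge-glues` reaches it from `H`.
      _ , match (k ∘ π ∘ inˡ) kι refl (ke ∘ image ∘ left)
        , match (k ∘ π ∘ inʳ) (cong k (sym (merge-glues (inˡ (o G)) (inʳ (ι H))))) ko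
            (ke ∘ image ∘ right)
      where π = proj₂ (merge (inˡ (o G)) (inʳ (ι H)))

    private
      ρ = proj₂ (merge (inˡ (ι G)) (inʳ (ι H)))
      π = proj₂ (merge (ρ (inˡ (o G))) (ρ (inʳ (o H))))

    -- The copairing descends in two stages: through `ρ` because the inputs agree at `s`, then
    -- through `π` because the resulting `l` sends both outputs to `t`.
    match-parallel : ∀ {s t} → Match G s t → Match H s t → Match (parallel G H) s t
    match-parallel (match g gι go ge) (match h hι ho he)
      with l , lρ ← merge-factors (inˡ (ι G)) (inʳ (ι H)) (copair g h)
             (trans (copair-ˡ g h (ι G)) (trans gι (sym (trans (copair-ʳ g h (ι H)) hι))))
      with k , kπ ← merge-factors (ρ (inˡ (o G))) (ρ (inʳ (o H))) l
             (trans (trans (lρ _) (trans (copair-ˡ g h (o G)) go))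
               (sym (trans (lρ _) (trans (copair-ʳ g h (o H)) ho))))
      = match k
          (trans (kπρ _) (trans (copair-ˡ g h (ι G)) gι))
          (trans (kπρ _) (trans (copair-ˡ g h (o G)) go))
          (preserves-Image (preserves-Image
            (preserves-resp-≗ {E = edge G ⊎ᴱ edge H} (sym ∘ kπρ)
              (copair-preserves g h ge he))))
      where
      kπρ : k ∘ π ∘ ρ ≗ copair g h
      kπρ i = trans (kπ (ρ i)) (lρ i)

    unmatch-parallel : ∀ {s t} → Match (parallel G H) s t → Match G s t × Match H s t
    unmatch-parallel (match k kι ko ke) =
        match (k ∘ π ∘ ρ ∘ inˡ) kι ko (ke ∘ image ∘ image ∘ left)
      -- The endpoints of `parallel G H` are those of `G`; the gluing equations carry them over to
      -- `H`.
      , match (k ∘ π ∘ ρ ∘ inʳ)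
          (trans (cong (k ∘ π) (sym (merge-glues (inˡ (ι G)) (inʳ (ι H))))) kι)
          (trans (cong k (sym (merge-glues (ρ (inˡ (o G))) (ρ (inʳ (o H)))))) ko)
          (ke ∘ image ∘ image ∘ right)

  match-° : ∀ {u s t} → Match (graph u) s t → Match (graph (u °)) t s
  match-° (match h hι ho he) = match h ho hι he

  unmatch-° : ∀ {u s t} → Match (graph (u °)) s t → Match (graph u) t s
  unmatch-° (match h hι ho he) = match h ho hι he

  -- The homomorphism behind `G ⊴ H` starts at `H`, so precomposition moves matches from `G` to `H`.
  match-∘ : ∀ {G H s t} → G ⊴ H → Match G s t → Match H s t
  match-∘ φ (match h hι ho he) = match (h ∘ Hom.map φ)
    (trans (cong h (Hom.map-ι φ)) hι)
    (trans (cong h (Hom.map-o φ)) ho)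
    (he ∘ Hom.map-edge φ)

  -- Interpretation of an expression through matches of its terms.

  ⟦⟧⇒match : ∀ e {s t} → ⟦ e ⟧ σ s t → ∃[ u ] T e u × Match (graph u) s t
  -- Induction on the path with `e` fixed: each step of the path contributes one factor of the
  -- product.
  ⟦⁺⟧⇒match : ∀ e {s t} → TransClosure (⟦ e ⟧ σ) s t →
    ∃[ u ] T (e ⁺) u × Match (graph u) s t

  ⟦⟧⇒match (e ∪ f) (inj₁ st) with u , u∈ , M ← ⟦⟧⇒match e st = u , inj₁ u∈ , M
  ⟦⟧⇒match (e ∪ f) (inj₂ st) with u , u∈ , M ← ⟦⟧⇒match f st = u , inj₂ u∈ , M
  ⟦⟧⇒match (e · f) (_ , sr , rt)
    with u , u∈ , M ← ⟦⟧⇒match e sr | v , v∈ , N ← ⟦⟧⇒match f rt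
    = u · v , (u , v , u∈ , v∈ , refl) , match-series M N
  ⟦⟧⇒match (e ∩ f) (st , st′)
    with u , u∈ , M ← ⟦⟧⇒match e st | v , v∈ , N ← ⟦⟧⇒match f st′
    = u ∩ v , (u , v , u∈ , v∈ , refl) , match-parallel M N
  ⟦⟧⇒match (e ⁺) st = ⟦⁺⟧⇒match e st
  ⟦⟧⇒match (e °) ts with u , u∈ , M ← ⟦⟧⇒match e ts
    = u ° , (u , u∈ , refl) , match-° {u} M
  ⟦⟧⇒match 𝟙 {s} refl = 𝟙 , refl , match (λ _ → s) refl refl (λ ())
  ⟦⟧⇒match ⊤ {s} {t} _ =
    ⊤ , refl , match (λ { zero → s ; (suc _) → t }) refl refl (λ ())
  ⟦⟧⇒match (var x) {s} {t} st =
    var x , refl , match (λ { zero → s ; (suc _) → t }) refl refl (λ { arrow → st })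

  ⟦⁺⟧⇒match e [ st ] with u , u∈ , M ← ⟦⟧⇒match e st
    -- The index counts the factors after the first, so 0 stands for a single factor.
    = u , (0 , u ∷ [] , u∈ ∷ [] , refl) , M
  ⟦⁺⟧⇒match e (sr ∷ rt)
    with u , u∈ , M ← ⟦⟧⇒match e sr
       | _ , (n , v ∷ vs , vs∈ , refl) , N ← ⟦⁺⟧⇒match e rt
    -- With the tail exposed as `v ∷ vs`, `foldr₁` unfolds to `u` times the product of the tail,
    -- whose graph is a `series`.
    = _ , (suc n , u ∷ v ∷ vs , u∈ ∷ vs∈ , refl) , match-series M N

  match⇒⟦⟧ : ∀ e {u s t} → T e u → Match (graph u) s t → ⟦ e ⟧ σ s t
  match⇒⟦⁺⟧ : ∀ e {s t} (us : Vec (Term X) (suc n)) → All (T e) us →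
    Match (graph (foldr₁ _·_ us)) s t → TransClosure (⟦ e ⟧ σ) s t

  match⇒⟦⟧ (e ∪ f) (inj₁ u∈) M = inj₁ (match⇒⟦⟧ e u∈ M)
  match⇒⟦⟧ (e ∪ f) (inj₂ u∈) M = inj₂ (match⇒⟦⟧ f u∈ M)
  match⇒⟦⟧ (e · f) (u , v , u∈ , v∈ , refl) M
    with r , N , O ← unmatch-series {graph u} {graph v} M
    = r , match⇒⟦⟧ e u∈ N , match⇒⟦⟧ f v∈ O
  match⇒⟦⟧ (e ∩ f) (u , v , u∈ , v∈ , refl) M
    with N , O ← unmatch-parallel {graph u} {graph v} M
    = match⇒⟦⟧ e u∈ N , match⇒⟦⟧ f v∈ O
  match⇒⟦⟧ (e ⁺) (_ , us , us∈ , refl) M = match⇒⟦⁺⟧ e us us∈ M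
  match⇒⟦⟧ (e °) (u , u∈ , refl) M = match⇒⟦⟧ e u∈ (unmatch-° {u} M)
  -- The single vertex is both input and output, so its image equals both `s` and `t`.
  match⇒⟦⟧ 𝟙 refl (match _ hι ho _) = trans (sym hι) ho
  match⇒⟦⟧ ⊤ refl _ = tt
  match⇒⟦⟧ (var x) refl (match _ refl refl he) = he arrow

  match⇒⟦⁺⟧ e (u ∷ []) (u∈ ∷ []) M = [ match⇒⟦⟧ e u∈ M ]
  match⇒⟦⁺⟧ e (u ∷ v ∷ vs) (u∈ ∷ vs∈) M
    with r , N , O ← unmatch-series {graph u} {graph (foldr₁ _·_ (v ∷ vs))} M
    = match⇒⟦⟧ e u∈ N ∷ match⇒⟦⁺⟧ e (v ∷ vs) vs∈ O

-- Graphs as relational structures, and the comparison of the three properties.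

module _ {X : Set a} where

  ≅-refl : {G : Graph X} → G ≅ G
  ≅-refl = record
    { bijection = ↔-id _ ; to-ι = refl ; to-o = refl ; to-edge = ⇔-id _ }

  -- By contravariance the inverse bijection is the homomorphism. An edge of `H` is reflected into
  -- `G` once its ends are written as images under `to`.
  ≅⇒⊴ : {G H : Graph X} → G ≅ H → G ⊴ H
  ≅⇒⊴ {G} {H} G≅H = record
    { map      = from
    ; map-ι    = trans (cong from (sym to-ι)) (strictlyInverseʳ (ι G))
    ; map-o    = trans (cong from (sym to-o)) (strictlyInverseʳ (o G))
    ; map-edge = λ {p} {x} {q} e → Equivalence.from to-edge
        (subst₂ (λ p q → edge H p x q)
          (sym (strictlyInverseˡ p)) (sym (strictlyInverseˡ q)) e)
    }
    where
    open _≅_ G≅H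
    open Inverse bijection using (from; strictlyInverseˡ; strictlyInverseʳ)

  ⊴-trans : {G H K : Graph X} → G ⊴ H → H ⊴ K → G ⊴ K
  ⊴-trans φ ψ = record
    { map      = Hom.map φ ∘ Hom.map ψ
    ; map-ι    = trans (cong (Hom.map φ) (Hom.map-ι ψ)) (Hom.map-ι φ)
    ; map-o    = trans (cong (Hom.map φ) (Hom.map-o ψ)) (Hom.map-o φ)
    ; map-edge = Hom.map-edge φ ∘ Hom.map-edge ψ
    }

  module _ (ℓ : Level) (G : Graph X) where

    -- Vertices live at level zero and edges at level `a`; lifting both makes the graph a structure
    -- in the universe over which `Rel⊨ (a ⊔ ℓ)` quantifies.
    Vertex : Set (a ⊔ ℓ)
    Vertex = Lift (a ⊔ ℓ) (Fin (size G))

    adjacent : X → Rel Vertex (a ⊔ ℓ)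
    adjacent x p q = Lift (a ⊔ ℓ) (edge G (lower p) x (lower q))

    match-id : Match adjacent G (lift (ι G)) (lift (o G))
    match-id = match lift refl refl lift

    match⇒⊴ : ∀ {H} → Match adjacent H (lift (ι G)) (lift (o G)) → G ⊴ H
    match⇒⊴ (match h hι ho he) = record
      { map      = lower ∘ h
      ; map-ι    = cong lower hι
      ; map-o    = cong lower ho
      ; map-edge = lower ∘ he
      }

  module _ (ℓ : Level) (e f : Expr X) where

    Rel⊨⇒T⊆ : Rel⊨ (a ⊔ ℓ) e f → T e ⊆ ↓[ _≲_ ] (T f)
    Rel⊨⇒T⊆ e≤f {u} u∈
      with v , v∈ , M ← ⟦⟧⇒match _ f
             (e≤f (adjacent ℓ (graph u)) (match⇒⟦⟧ _ e u∈ (match-id ℓ (graph u))))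
      = v , v∈ , match⇒⊴ ℓ (graph u) M

    T⊆⇒Rel⊨ : T e ⊆ ↓[ _≲_ ] (T f) → Rel⊨ (a ⊔ ℓ) e f
    T⊆⇒Rel⊨ T⊆ σ st with u , u∈ , M ← ⟦⟧⇒match σ e st
      with v , v∈ , u≲v ← T⊆ u∈
      = match⇒⟦⟧ σ f v∈ (match-∘ σ u≲v M)

  module _ (e f : Expr X) where

    -- Members of `𝒢 e` are graphs of terms only up to isomorphism. The isomorphism is absorbed into
    -- `⊴`, on the smaller side here and on the larger side in the converse.
    T⊆⇒𝒢⊆ : T e ⊆ ↓[ _≲_ ] (T f) → 𝒢 e ⊆ ↓[ _⊴_ ] (𝒢 f)
    T⊆⇒𝒢⊆ T⊆ (u , u∈ , G≅u) with v , v∈ , u≲v ← T⊆ u∈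
      = graph v , (v , v∈ , ≅-refl) , ⊴-trans (≅⇒⊴ G≅u) u≲v

    𝒢⊆⇒T⊆ : 𝒢 e ⊆ ↓[ _⊴_ ] (𝒢 f) → T e ⊆ ↓[ _≲_ ] (T f)
    𝒢⊆⇒T⊆ 𝒢⊆ u∈ with H , (v , v∈ , H≅v) , u⊴H ← 𝒢⊆ (_ , u∈ , ≅-refl)
      = v , v∈ , ⊴-trans u⊴H (≅⇒⊴ H≅v)

theorem3p9 : {a : Level} (ℓ : Level) {X : Set a} (e f : Expr X) →
    (Rel⊨ (a ⊔ ℓ) e f ⇔ T e ⊆ ↓[ _≲_ ] (T f))
    × (T e ⊆ ↓[ _≲_ ] (T f) ⇔ 𝒢 e ⊆ ↓[ _⊴_ ] (𝒢 f))
theorem3p9 {a} ℓ e f =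
    mk⇔ {A = Rel⊨ (a ⊔ ℓ) e f} {B = T⊆}
      (Rel⊨⇒T⊆ ℓ e f) (T⊆⇒Rel⊨ ℓ e f)
  , mk⇔ {A = T⊆} {B = 𝒢 e ⊆ ↓[ _⊴_ ] (𝒢 f)}
      (T⊆⇒𝒢⊆ e f) (𝒢⊆⇒T⊆ e f)
  where T⊆ = T e ⊆ ↓[ _≲_ ] (T f)
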